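{- Let $G$ be a tripartite graph with parts $V_1$, $V_2$ and $V_3$ such that $|V_1|=|V_2|=|V_3|=n>240$. Let $(n^2-n+\alpha' n^{\delta_a})$, $(n^2-n+\beta' n^{\delta_b})$ and $(n^2-n+\gamma' n^{\delta_c})$ be the number of edges of $G[V_1,V_2]$, $G[V_1,V_3]$ and $G[V_2,V_3]$, respectively. If $$\alpha'\beta'\, n^{(\delta_a+\delta_b-1)}+\gamma'\, n^{(\delta_c-1)}>1,$$ $$\gamma'\beta'\, n^{(\delta_c+\delta_b-1)}+\alpha'\, n^{(\delta_a-1)}>1,$$ $$\alpha'\gamma'\, n^{(\delta_a+\delta_c-1)}+\beta'\, n^{(\delta_b-1)}>1,$$ then $G$ contains a triangle-factor.
   Context: For a tripartite graph $G$ with parts $V_1,V_2,V_3$, $G[V_i,V_j]$ denotes the bipartite graph consisting of the edges of $G$ between $V_i$ and $V_j$. The quantities $\alpha',\beta',\gamma',\delta_a,\delta_b,\delta_c$ are real numbers used to express the three edge counts. When $|V_1|=|V_2|=|V_3|=n$, $G$ contains a triangle-factor if it contains $n$ vertex-disjoint triangles.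
   Formalization: The formal theorem adds that α′, β′, γ′ are not all negative; as stated the claim fails, e.g. all three equal to −1 with all exponents 1, where a vertex of V₁ may have no neighbour in V₂. -}

module Defs where

open import Level using (Level; 0ℓ; suc; _⊔_)
open import Algebra.Apartness.Bundles using (HeytingCommutativeRing; HeytingField)
open import Algebra.Bundles using (CommutativeRing)
open import Data.Fin using (Fin)
open import Data.List using (length; filter; allFin; cartesianProduct)
open import Data.Nat as ℕ using (ℕ)
open import Data.Product using (Σ-syntax; ∃-syntax; _×_; _,_; proj₁; proj₂)
open import Data.Sum using (_⊎_)
open import Function.Bundles using (_⇔_)
open import Relation.Binary using (Rel; Decidable; Symmetric; IsStrictPartialOrder)
open import Relation.Binary.PropositionalEquality using (_≡_; _≢_)
open import Relation.Nullary using (¬_)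
import Algebra.Properties.Semiring.Mult as Mult

-- The standard library has no real numbers, so they enter as a Cauchy-complete
-- Archimedean ordered field, equipped with the power function n ^ x for
-- a natural base n ≥ 1 and a real exponent x.  These axioms determine ℝ up
-- to isomorphism.  Trichotomy of _<_ is not assumed (nor excluded), so both
-- the classical and the constructive reals are intended models.
record Reals (c ℓ₁ ℓ₂ ℓ₃ : Level) : Set (suc (c ⊔ ℓ₁ ⊔ ℓ₂ ⊔ ℓ₃)) where
  infix  4 _<_ _>_ _≤_
  infixr 8 _^_

  field
    heytingField : HeytingField c ℓ₁ ℓ₂

  open HeytingField heytingField public
  open HeytingCommutativeRing heytingCommutativeRing public using (commutativeRing)
  open CommutativeRing commutativeRing public using (semiring)
  open Mult semiring using () renaming (_×_ to _×ℕ_)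

  field
    _<_                  : Rel Carrier ℓ₃
    isStrictPartialOrder : IsStrictPartialOrder _≈_ _<_
    #⇔<⊎>                : ∀ {x y} → x # y ⇔ (x < y ⊎ y < x)
    +-monoˡ-<            : ∀ {x y} z → x < y → x + z < y + z
    *-pos                : ∀ {x y} → 0# < x → 0# < y → 0# < x * y

  _>_ : Rel Carrier ℓ₃
  x > y = y < x

  _≤_ : Rel Carrier ℓ₃
  x ≤ y = ¬ (y < x)

  fromℕ : ℕ → Carrier
  fromℕ n = n ×ℕ 1#

  -- The bound is one-sided, but i and j may be exchanged.
  IsCauchy : (ℕ → Carrier) → Set ℓ₃
  IsCauchy s = ∀ k → ∃[ N ] (∀ i j → N ℕ.≤ i → N ℕ.≤ j →
                               fromℕ k * (s i - s j) < 1#)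

  _ConvergesTo_ : (ℕ → Carrier) → Carrier → Set ℓ₃
  s ConvergesTo l = ∀ k → ∃[ N ] (∀ i → N ℕ.≤ i →
    fromℕ k * (s i - l) < 1# × fromℕ k * (l - s i) < 1#)

  field
    archimedean : ∀ x → ∃[ n ] x < fromℕ n
    complete    : ∀ s → IsCauchy s → ∃[ l ] s ConvergesTo l

  -- For each n ≥ 1, the map x ↦ n ^ x is the only monotone homomorphism from
  -- addition to multiplication that sends 1 to n; 0 ^ x is unconstrained.
  field
    _^_          : ℕ → Carrier → Carrier
    ^-identityʳ  : ∀ n .{{_ : ℕ.NonZero n}} → n ^ 1# ≈ fromℕ n
    ^-homo-+     : ∀ n .{{_ : ℕ.NonZero n}} x y → n ^ (x + y) ≈ n ^ x * n ^ y
    ^-monoʳ-≤    : ∀ n .{{_ : ℕ.NonZero n}} {x y} → x ≤ y → n ^ x ≤ n ^ y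

-- (i , x) is the x-th vertex of the i-th part.
Vertex : ℕ → Set
Vertex n = Fin 3 × Fin n

-- Finite simple tripartite graphs with all three parts of size n.
record TripartiteGraph (n : ℕ) : Set₁ where
  field
    Adj       : Rel (Vertex n) 0ℓ
    adj?      : Decidable Adj
    adj-sym   : Symmetric Adj
    adj-parts : ∀ {u v} → Adj u v → proj₁ u ≢ proj₁ v

module _ {n : ℕ} (G : TripartiteGraph n) where
  open TripartiteGraph G

  -- For i ≢ j this is the number of edges of G[Vᵢ,Vⱼ]: each edge is listed
  -- once, by its endpoint in part i and its endpoint in part j.
  edgeCount : Fin 3 → Fin 3 → ℕ
  edgeCount i j = length (filter (λ (x , y) → adj? (i , x) (j , y))
                                 (cartesianProduct (allFin n) (allFin n)))

  Triangle : Set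
  Triangle = Σ[ t ∈ (Fin 3 → Vertex n) ] (∀ {i j} → i ≢ j → Adj (t i) (t j))

  Disjoint : Triangle → Triangle → Set
  Disjoint (s , _) (t , _) = ∀ i j → s i ≢ t j

  TriangleFactor : Set
  TriangleFactor = Σ[ T ∈ (Fin n → Triangle) ]
                     (∀ {k l} → k ≢ l → Disjoint (T k) (T l))

{-# OPTIONS --safe #-}
-- Let a, b, c be the numbers of non-edges between the three pairs of parts.
-- Multiplied by n, the hypotheses read c < (n - a)(n - b) and its two
-- analogues over ℤ; the sign condition then forces a, b, c < n.
--
-- A bipartite graph on n + n vertices with fewer than n non-edges has a perfect
-- matching.  Matching V₁ with V₂ and then the matched pairs with V₃ therefore
-- settles every case with b + c < n, in particular a = n - 1.
--
-- Otherwise, suppose first that some z in V₃ meets at least n non-edges.  Since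
-- a < (n - b)(n - c), z lies in a triangle; deleting it leaves a graph covered
-- by the first case.  If there is no such z, call v in V₁ and w in V₂ a bad pair
-- when they meet together at least n non-edges towards V₃.  As b + c < 2n, the
-- bad pairs form a star, and counting gives fewer than n - a of them, so V₁ and
-- V₂ can be matched without bad pairs.  The graph between the matched pairs and
-- V₃ has at most 2n - 3 non-edges and no isolated vertex, which again implies a
-- perfect matching.

module Submission where

open import Defs
open import Algebra.Bundles using (CommutativeRing)
open import Data.Empty using (⊥)
open import Data.Fin using (Fin; zero; suc; punchIn; punchOut)
open import Data.Fin.Patterns using (0F; 1F; 2F)
open import Data.Fin.Permutation as Perm
  using (Permutation′; _⟨$⟩ʳ_; _⟨$⟩ˡ_; insert; insert-punchIn)
open import Data.Fin.Properties using (_≟_; any?; punchIn-punchOut; punchInᵢ≢i; ¬∀⟶∃¬)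
open import Data.List as List using (length; filter; tabulate; cartesianProduct)
import Data.List.Properties as List
open import Data.Maybe using (nothing)
open import Data.Nat as ℕ using (ℕ; zero; suc; z≤n; s≤s)
import Data.Nat.Properties as ℕ
import Data.Nat.Tactic.RingSolver as ℕ-RingSolver
open import Data.Product using (Σ-syntax; ∃-syntax; _×_; _,_; proj₁; proj₂)
open import Data.Product.Properties using (,-injective)
open import Data.Sum using (_⊎_; inj₁; inj₂; [_,_]′)
open import Function using (_∘_; id; flip; Equivalence)
open import Level using (Level; 0ℓ)
open import Relation.Binary using (IsStrictPartialOrder)
open import Relation.Binary.PropositionalEquality as ≡ using (_≡_; _≢_)
open import Relation.Nullary using (¬_; Dec; yes; no; contradiction; ¬?)
open import Relation.Nullary.Decidable using (_×-dec_; decidable-stable)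
open import Relation.Unary using (Pred; Decidable)
import Tactic.RingSolver as RingSolver
open import Tactic.RingSolver.Core.AlmostCommutativeRing
  using (AlmostCommutativeRing; fromCommutativeRing)

private
  variable
    ℓ : Level
    m n : ℕ

module Matchings where

  open import Algebra.Properties.Semiring.Sum ℕ.+-*-semiring
  open import Data.Nat using (_+_; _*_; _∸_; _≤_; _<_; _≤?_; s≤s⁻¹)
  open ℕ.≤-Reasoning
  open ≡ using (refl; sym; trans; cong; subst)
  open ℕ-RingSolver using (solve-∀)

  -- Sums of natural numbers over finite index sets

  sum-mono : {f g : Fin n → ℕ} → (∀ i → f i ≤ g i) → sum f ≤ sum g
  sum-mono {zero}  f≤g = z≤n
  sum-mono {suc n} f≤g = ℕ.+-mono-≤ (f≤g zero) (sum-mono (f≤g ∘ suc))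

  sum-replicate-* : ∀ n x → ∑[ _ < n ] x ≡ n * x
  sum-replicate-* zero    x = refl
  sum-replicate-* (suc n) x = cong (x +_) (sum-replicate-* n x)

  term≤sum : (f : Fin n → ℕ) → ∀ i → f i ≤ sum f
  term≤sum {suc n} f i = begin
    f i                           ≤⟨ ℕ.m≤m+n (f i) _ ⟩
    f i + sum (f ∘ punchIn i)     ≡⟨ sum-remove f ⟨
    sum f                         ∎

  two-terms≤sum : (f : Fin n → ℕ) → ∀ {i j} → i ≢ j → f i + f j ≤ sum f
  two-terms≤sum {suc n} f {i} {j} i≢j = begin
    f i + f j                               ≡⟨ cong (λ k → f i + f k) (punchIn-punchOut i≢j) ⟨
    f i + f (punchIn i (punchOut i≢j))      ≤⟨ ℕ.+-monoʳ-≤ (f i) (term≤sum (f ∘ punchIn i) _) ⟩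
    f i + sum (f ∘ punchIn i)               ≡⟨ sum-remove f ⟨
    sum f                                   ∎

  all-positive⇒n≤sum : (f : Fin n → ℕ) → (∀ i → f i ≢ 0) → n ≤ sum f
  all-positive⇒n≤sum {n} f f≢0 = begin
    n              ≡⟨ ℕ.*-identityʳ n ⟨
    n * 1          ≡⟨ sum-replicate-* n 1 ⟨
    ∑[ _ < n ] 1   ≤⟨ sum-mono (λ i → ℕ.n≢0⇒n>0 (f≢0 i)) ⟩
    sum f          ∎

  sum<n⇒∃-zero : (f : Fin n → ℕ) → sum f < n → ∃[ i ] f i ≡ 0
  sum<n⇒∃-zero {n} f Σf<n with any? (λ i → f i ℕ.≟ 0)
  ... | yes fi≡0 = fi≡0
  ... | no  none = contradiction Σf<n (ℕ.≤⇒≯ (all-positive⇒n≤sum f (λ i fi≡0 → none (i , fi≡0))))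

  all-zero⇒sum≡0 : (f : Fin n → ℕ) → (∀ i → f i ≡ 0) → sum f ≡ 0
  all-zero⇒sum≡0 {n} f f≡0 = trans (sum-cong-≗ f≡0) (sum-replicate-zero n)

  sum≢0⇒∃-positive : (f : Fin n → ℕ) → sum f ≢ 0 → ∃[ i ] f i ≢ 0
  sum≢0⇒∃-positive f Σf≢0 =
    ¬∀⟶∃¬ _ _ (λ i → f i ℕ.≟ 0) (Σf≢0 ∘ all-zero⇒sum≡0 f)

  -- If one term were zero, the other n - 1 terms would have to add up to n.
  all≤1∧n≤sum⇒positive : (f : Fin n → ℕ) → (∀ i → f i ≤ 1) → n ≤ sum f → ∀ i → f i ≢ 0
  all≤1∧n≤sum⇒positive {suc n} f f≤1 n<Σf i fi≡0 = contradiction n<Σf (ℕ.≤⇒≯ (begin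
    sum f                       ≡⟨ sum-remove {i = i} f ⟩
    f i + sum (f ∘ punchIn i)   ≡⟨ cong (_+ sum (f ∘ punchIn i)) fi≡0 ⟩
    sum (f ∘ punchIn i)         ≤⟨ sum-mono (f≤1 ∘ punchIn i) ⟩
    ∑[ _ < n ] 1                ≡⟨ sum-replicate-* n 1 ⟩
    n * 1                       ≡⟨ ℕ.*-identityʳ n ⟩
    n                           ∎))

  -- Matrices of non-edges and their minors

  -- A matrix records non-edges of a bipartite graph with multiplicity, so
  -- that an entry is zero when the edge is present.
  Matrix : ℕ → Set
  Matrix n = Fin n → Fin n → ℕ

  row col : Matrix n → Fin n → ℕ
  row M i = sum (M i)
  col M j = sum (λ i → M i j)

  total : Matrix n → ℕ
  total M = sum (row M)

  minor : Matrix (suc n) → Fin (suc n) → Fin (suc n) → Matrix n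
  minor M i j k l = M (punchIn i k) (punchIn j l)

  -- Row `i` and column `j` both count the entry where they cross; the formula is exact because that
  -- entry is zero.
  total-minor : (M : Matrix (suc n)) → ∀ {i j} → M i j ≡ 0 →
                total M ≡ (row M i + col M j) + total (minor M i j)
  total-minor M {i} {j} Mij≡0 = begin-equality
    total M
      ≡⟨ sum-remove {i = i} (row M) ⟩
    row M i + sum (row M ∘ punchIn i)
      ≡⟨ cong (row M i +_) (sum-cong-≗ (λ k → sum-remove {i = j} (M (punchIn i k)))) ⟩
    row M i + sum (λ k → M (punchIn i k) j + row (minor M i j) k)
      ≡⟨ cong (row M i +_) (∑-distrib-+ (λ k → M (punchIn i k) j) _) ⟩
    row M i + (sum (λ k → M (punchIn i k) j) + total (minor M i j))
      ≡⟨ cong (λ x → row M i + (x + total (minor M i j))) col-remove ⟨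
    row M i + (col M j + total (minor M i j))
      ≡⟨ ℕ.+-assoc (row M i) _ _ ⟨
    (row M i + col M j) + total (minor M i j) ∎
    where
    col-remove : col M j ≡ sum (λ k → M (punchIn i k) j)
    col-remove = trans (sum-remove {i = i} (λ k → M k j)) (cong (_+ sum (λ k → M (punchIn i k) j)) Mij≡0)

  row-minor≤ : (M : Matrix (suc n)) → ∀ i j k → row (minor M i j) k ≤ row M (punchIn i k)
  row-minor≤ M i j k = begin
    row (minor M i j) k                       ≤⟨ ℕ.m≤n+m _ _ ⟩
    M (punchIn i k) j + row (minor M i j) k   ≡⟨ sum-remove {i = j} (M (punchIn i k)) ⟨
    row M (punchIn i k)                       ∎

  total-minor≤ : (M : Matrix (suc n)) → ∀ i j → total (minor M i j) ≤ total M
  total-minor≤ M i j = begin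
    total (minor M i j)                  ≤⟨ sum-mono (row-minor≤ M i j) ⟩
    sum (row M ∘ punchIn i)              ≤⟨ ℕ.m≤n+m _ _ ⟩
    row M i + sum (row M ∘ punchIn i)    ≡⟨ sum-remove {i = i} (row M) ⟨
    total M                              ∎

  punchIn-elim : (P : Pred (Fin (suc n)) ℓ) → ∀ i → P i → (∀ k → P (punchIn i k)) → ∀ k → P k
  punchIn-elim P i Pi Pk k with i ≟ k
  ... | yes refl = Pi
  ... | no  i≢k  = subst P (punchIn-punchOut i≢k) (Pk (punchOut i≢k))

  insert-self : ∀ i j (π : Permutation′ n) → insert i j π ⟨$⟩ʳ i ≡ j
  insert-self i j π with i ≟ i
  ... | yes _  = refl
  ... | no i≢i = contradiction refl i≢i

  -- Perfect matchings in nearly complete bipartite graphs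

  ZeroMatching : Matrix n → Set
  ZeroMatching {n} M = Σ[ π ∈ Permutation′ n ] ∀ i → M i (π ⟨$⟩ʳ i) ≡ 0

  extend-matching : (M : Matrix (suc n)) → ∀ {i j} → M i j ≡ 0 →
                    ZeroMatching (minor M i j) → ZeroMatching M
  extend-matching M {i} {j} Mij≡0 (π , π-zero) = insert i j π ,
    punchIn-elim _ i
      (trans (cong (M i) (insert-self i j π)) Mij≡0)
      (λ k → trans (cong (M _) (insert-punchIn i j π k)) (π-zero k))

  -- Induction on the size. A row of positive weight still contains a zero, because its weight is
  -- below the number of columns. Deleting the lines through that zero lowers the total by at least
  -- one, as fast as the bound falls.
  sparse-matching : (M : Matrix n) → total M ≤ n ∸ 1 → ZeroMatching M
  sparse-matching {zero}  M _ = Perm.id , λ ()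
  sparse-matching {suc n} M ΣM≤n with total M ℕ.≟ 0
  ... | yes ΣM≡0 = Perm.id , λ i → ℕ.n≤0⇒n≡0 (begin
    M i i      ≤⟨ term≤sum (M i) i ⟩
    row M i    ≤⟨ term≤sum (row M) i ⟩
    total M    ≡⟨ ΣM≡0 ⟩
    0          ∎)
  ... | no ΣM≢0 with i , row≢0 ← sum≢0⇒∃-positive (row M) ΣM≢0
                with j , Mij≡0 ← sum<n⇒∃-zero (M i) (s≤s (ℕ.≤-trans (term≤sum (row M) i) ΣM≤n)) =
    extend-matching M Mij≡0 (sparse-matching (minor M i j) (ℕ.∸-monoˡ-≤ 1 (begin
      1 + total (minor M i j)                     ≤⟨ ℕ.+-monoˡ-≤ _ (ℕ.≤-trans (ℕ.n≢0⇒n>0 row≢0) (ℕ.m≤m+n _ _)) ⟩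
      (row M i + col M j) + total (minor M i j)   ≡⟨ total-minor M Mij≡0 ⟨
      total M                                     ≤⟨ ΣM≤n ⟩
      n                                           ∎)))

  -- If no zero entry lies on lines of total weight two, then every line has
  -- weight at most one and the lines of weight one would fill the matrix.
  ∃-heavy-zero : (M : Matrix n) → n ≤ total M → n ≢ 0 →
                 (∀ i → ∃[ j ] M i j ≡ 0) → (∀ j → ∃[ i ] M i j ≡ 0) →
                 ∃[ i ] ∃[ j ] M i j ≡ 0 × 2 ≤ row M i + col M j
  ∃-heavy-zero {n} M n≤ΣM n≢0 row-zero col-zero
    with any? (λ i → any? (λ j → (M i j ℕ.≟ 0) ×-dec (2 ≤? row M i + col M j)))
  ... | yes found = found
  ... | no  none  = contradiction (ℕ.≤-trans n≤ΣM (ℕ.≤-reflexive (all-zero⇒sum≡0 (row M) row≡0)))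
                                  (n≢0 ∘ ℕ.n≤0⇒n≡0)
    where
    light : ∀ {i j} → M i j ≡ 0 → row M i + col M j ≤ 1
    light {i} {j} Mij≡0 = s≤s⁻¹ (ℕ.≰⇒> (λ 2≤ → none (i , j , Mij≡0 , 2≤)))

    col≢0 : ∀ j → col M j ≢ 0
    col≢0 = all≤1∧n≤sum⇒positive (col M)
      (λ j → ℕ.m+n≤o⇒n≤o _ (light (proj₂ (col-zero j))))
      (ℕ.≤-trans n≤ΣM (ℕ.≤-reflexive (∑-comm M)))

    -- A zero of row `i` lies in a column of weight at least one, which uses up all that `light`
    -- allows to the two lines.
    row≡0 : ∀ i → row M i ≡ 0
    row≡0 i with j , Mij≡0 ← row-zero i = ℕ.n≤0⇒n≡0 (ℕ.+-cancelʳ-≤ 1 _ _ (begin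
      row M i + 1         ≤⟨ ℕ.+-monoʳ-≤ _ (ℕ.n≢0⇒n>0 (col≢0 j)) ⟩
      row M i + col M j   ≤⟨ light Mij≡0 ⟩
      1                   ∎))

  -- Induction on the size, deleting the lines through a suitable zero: one on very heavy lines if
  -- there is one, otherwise one on lines of weight at least two, so that the bound 2n - 3 survives.
  -- The bound is sharp: two rows whose only zeros lie in the same column already have weight 2n -
  -- 2.
  semi-sparse-matching : (M : Matrix n) → total M + 3 ≤ n + n →
    (∀ i → ∃[ j ] M i j ≡ 0) → (∀ j → ∃[ i ] M i j ≡ 0) → ZeroMatching M
  semi-sparse-matching {zero}  M _ _ _ = Perm.id , λ ()
  semi-sparse-matching {suc n} M ΣM+3≤2n row-zero col-zero with total M ≤? n
  ... | yes ΣM≤n = sparse-matching M ΣM≤n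
  ... | no  ΣM≰n with any? (λ i → any? (λ j → (M i j ℕ.≟ 0) ×-dec (n ≤? row M i + col M j)))
  -- The total is at most 2n - 1 here, since `M` has size `suc n`. Removing weight at least `n`
  -- leaves at most n - 1, which is sparse for size `n`.
  ...   | yes (i , j , Mij≡0 , n≤) =
    extend-matching M Mij≡0 (sparse-matching (minor M i j) (ℕ.∸-monoˡ-≤ 1 (ℕ.+-cancelˡ-≤ (2 + n) _ _ (begin
      2 + n + (1 + total (minor M i j))                ≡⟨ lemma n _ ⟩
      n + total (minor M i j) + 3                      ≤⟨ ℕ.+-monoˡ-≤ 3 (ℕ.+-monoˡ-≤ _ n≤) ⟩
      row M i + col M j + total (minor M i j) + 3      ≡⟨ cong (_+ 3) (total-minor M Mij≡0) ⟨
      total M + 3                                      ≤⟨ ΣM+3≤2n ⟩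
      suc n + suc n                                    ≡⟨ ℕ.+-suc (suc n) n ⟩
      2 + n + n                                        ∎))))
    where
    lemma : ∀ n x → 2 + n + (1 + x) ≡ n + x + 3
    lemma = solve-∀
  ...   | no none
        with i , j , Mij≡0 , 2≤ ← ∃-heavy-zero M (ℕ.≰⇒> ΣM≰n) (λ ()) row-zero col-zero =
    extend-matching M Mij≡0 (semi-sparse-matching (minor M i j)
      (ℕ.+-cancelˡ-≤ 2 _ _ (begin
        2 + (total (minor M i j) + 3)                ≡⟨ ℕ.+-assoc 2 (total (minor M i j)) 3 ⟨
        2 + total (minor M i j) + 3                  ≤⟨ ℕ.+-monoˡ-≤ 3 (ℕ.+-monoˡ-≤ _ 2≤) ⟩
        row M i + col M j + total (minor M i j) + 3  ≡⟨ cong (_+ 3) (total-minor M Mij≡0) ⟨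
        total M + 3                                  ≤⟨ ΣM+3≤2n ⟩
        suc n + suc n                                ≡⟨ ℕ.+-suc (suc n) n ⟩
        2 + (n + n)                                  ∎))
      (λ k → sum<n⇒∃-zero (minor M i j k)
         (ℕ.≤-<-trans (row-minor≤ M i j k) (row<n (punchIn i k))))
      (λ l → sum<n⇒∃-zero (λ k → minor M i j k l)
         (ℕ.≤-<-trans (row-minor≤ (flip M) j i l) (col<n (punchIn j l)))))
    where
    -- Every row contains a zero, to which `none` applies. Hence each row of a minor of size `n`
    -- again contains a zero; columns are treated alike.
    row<n : ∀ k → row M k < n
    row<n k with l , Mkl≡0 ← row-zero k =
      ℕ.≤-<-trans (ℕ.m≤m+n _ _) (ℕ.≰⇒> (λ n≤ → none (k , l , Mkl≡0 , n≤)))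

    col<n : ∀ l → col M l < n
    col<n l with k , Mkl≡0 ← col-zero l =
      ℕ.≤-<-trans (ℕ.m≤n+m _ (row M k)) (ℕ.≰⇒> (λ n≤ → none (k , l , Mkl≡0 , n≤)))

  -- Triangle-factors as pairs of permutations

  -- Triangles are indexed by their vertex in the first part. That `σ` and `τ` are permutations
  -- makes the triangles disjoint.
  TriangleMatching : (A B C : Matrix n) → Set
  TriangleMatching {n} A B C = Σ[ σ ∈ Permutation′ n ] Σ[ τ ∈ Permutation′ n ] ∀ k →
    A k (σ ⟨$⟩ʳ k) ≡ 0 × B k (τ ⟨$⟩ʳ k) ≡ 0 × C (σ ⟨$⟩ʳ k) (τ ⟨$⟩ʳ k) ≡ 0

  -- Exchanging the second and third parts swaps `A` with `B` and transposes `C`.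
  swap-parts : {A B C : Matrix n} → TriangleMatching B A (flip C) → TriangleMatching A B C
  swap-parts (σ , τ , zero-στ) = τ , σ , λ k → let b , a , c = zero-στ k in a , b , c

  extend-triangle : (A B C : Matrix (suc n)) → ∀ {v w z} →
    A v w ≡ 0 → B v z ≡ 0 → C w z ≡ 0 →
    TriangleMatching (minor A v w) (minor B v z) (minor C w z) → TriangleMatching A B C
  extend-triangle A B C {v} {w} {z} Avw≡0 Bvz≡0 Cwz≡0 (σ , τ , zero-στ) =
    insert v w σ , insert v z τ , punchIn-elim _ v at-v elsewhere
    where
    at-v : A v (insert v w σ ⟨$⟩ʳ v) ≡ 0 × B v (insert v z τ ⟨$⟩ʳ v) ≡ 0
           × C (insert v w σ ⟨$⟩ʳ v) (insert v z τ ⟨$⟩ʳ v) ≡ 0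
    at-v rewrite insert-self v w σ | insert-self v z τ = Avw≡0 , Bvz≡0 , Cwz≡0

    elsewhere : ∀ k → let v′ = punchIn v k in
      A v′ (insert v w σ ⟨$⟩ʳ v′) ≡ 0 × B v′ (insert v z τ ⟨$⟩ʳ v′) ≡ 0
      × C (insert v w σ ⟨$⟩ʳ v′) (insert v z τ ⟨$⟩ʳ v′) ≡ 0
    elsewhere k rewrite insert-punchIn v w σ k | insert-punchIn v z τ k = zero-στ k

  -- Contracting σ turns the third part into one side of a bipartite graph
  -- against the pairs (k , σ k).
  contract : Permutation′ n → (B C : Matrix n) → Matrix n
  contract σ B C k z = B k z + C (σ ⟨$⟩ʳ k) z

  col-contract : ∀ σ (B C : Matrix n) z → col (contract σ B C) z ≡ col B z + col C z
  col-contract σ B C z =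
    trans (∑-distrib-+ (λ k → B k z) _) (cong (col B z +_) (sym (sum-permute (λ w → C w z) σ)))

  row-contract : ∀ σ (B C : Matrix n) k → row (contract σ B C) k ≡ row B k + row C (σ ⟨$⟩ʳ k)
  row-contract σ B C k = ∑-distrib-+ (B k) _

  total-contract : ∀ σ (B C : Matrix n) → total (contract σ B C) ≡ total B + total C
  total-contract σ B C = begin-equality
    total (contract σ B C)                      ≡⟨ sum-cong-≗ (row-contract σ B C) ⟩
    sum (λ k → row B k + row C (σ ⟨$⟩ʳ k))      ≡⟨ ∑-distrib-+ (row B) _ ⟩
    total B + sum (λ k → row C (σ ⟨$⟩ʳ k))      ≡⟨ cong (total B +_) (sum-permute (row C) σ) ⟨
    total B + total C                           ∎

  -- A sum of naturals vanishes only with both terms, so a zero of the contraction is a vertex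
  -- adjacent to both ends of the pair.
  combine : (A B C : Matrix n) → ∀ σ → (∀ k → A k (σ ⟨$⟩ʳ k) ≡ 0) →
            ZeroMatching (contract σ B C) → TriangleMatching A B C
  combine A B C σ A≡0 (τ , N≡0) = σ , τ , λ k →
    A≡0 k , ℕ.m+n≡0⇒m≡0 (B k (τ ⟨$⟩ʳ k)) (N≡0 k) , ℕ.m+n≡0⇒n≡0 (B k (τ ⟨$⟩ʳ k)) (N≡0 k)

  -- The total of the contraction does not depend on `σ`, so any matching of the first two parts
  -- will do.
  sparse-triangle-matching : (A B C : Matrix n) →
    total A ≤ n ∸ 1 → total B + total C ≤ n ∸ 1 → TriangleMatching A B C
  sparse-triangle-matching A B C ΣA≤ ΣB+ΣC≤ with σ , A≡0 ← sparse-matching A ΣA≤ =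
    combine A B C σ A≡0
      (sparse-matching _ (ℕ.≤-trans (ℕ.≤-reflexive (total-contract σ B C)) ΣB+ΣC≤))

  -- Counting with indicators

  𝟙 : {P : Set} → Dec P → ℕ
  𝟙 (yes _) = 1
  𝟙 (no  _) = 0

  𝟙-no : {P : Set} (P? : Dec P) → ¬ P → 𝟙 P? ≡ 0
  𝟙-no (yes p) ¬p = contradiction p ¬p
  𝟙-no (no  _) ¬p = refl

  𝟙≡0⇒¬ : {P : Set} (P? : Dec P) → 𝟙 P? ≡ 0 → ¬ P
  𝟙≡0⇒¬ (no ¬p) _ = ¬p

  -- Markov's inequality.
  𝟙-sum-* : {P : Fin n → Set} (P? : ∀ i → Dec (P i)) {h : Fin n → ℕ} {x : ℕ} →
            (∀ i → P i → x ≤ h i) → sum (λ i → 𝟙 (P? i)) * x ≤ sum h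
  𝟙-sum-* P? {h} {x} x≤h = begin
    sum (λ i → 𝟙 (P? i)) * x     ≡⟨ *-distribʳ-sum x (λ i → 𝟙 (P? i)) ⟩
    sum (λ i → 𝟙 (P? i) * x)     ≤⟨ sum-mono each ⟩
    sum h                        ∎
    where
    each : ∀ i → 𝟙 (P? i) * x ≤ h i
    each i with P? i
    ... | no _  = z≤n
    ... | yes p = ℕ.≤-trans (ℕ.≤-reflexive (ℕ.*-identityˡ x)) (x≤h i p)

  zeros : (Fin n → ℕ) → Fin n → ℕ
  zeros f i = 𝟙 (f i ℕ.≟ 0)

  -- Each index either is a zero of `f` or contributes at least one to the sum.
  n∸sum≤zeros : (f : Fin n → ℕ) → n ∸ sum f ≤ sum (zeros f)
  n∸sum≤zeros {n} f = ℕ.m≤n+o⇒m∸n≤o n (sum f) (begin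
    n                            ≤⟨ all-positive⇒n≤sum (λ i → f i + zeros f i) positive ⟩
    sum (λ i → f i + zeros f i)  ≡⟨ ∑-distrib-+ f (zeros f) ⟩
    sum f + sum (zeros f)        ∎)
    where
    positive : ∀ i → f i + zeros f i ≢ 0
    positive i with f i ℕ.≟ 0
    ... | yes _    = ℕ.m+1+n≢0 (f i)
    ... | no  fi≢0 = fi≢0 ∘ ℕ.m+n≡0⇒m≡0 (f i)

  sum-* : (f g : Fin n → ℕ) → sum f * sum g ≡ sum (λ v → sum (λ w → f v * g w))
  sum-* f g = trans (*-distribʳ-sum (sum g) f) (sum-cong-≗ (λ v → *-distribˡ-sum (f v) g))

  -- The zeros of `f` and of `g` span a rectangle with at least as many cells as the product on the
  -- right. If no cell were a zero of `A`, then `total A` would be at least that large.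
  ∃-common-zero : (A : Matrix n) (f g : Fin n → ℕ) → total A < (n ∸ sum f) * (n ∸ sum g) →
                  ∃[ v ] ∃[ w ] A v w ≡ 0 × f v ≡ 0 × g w ≡ 0
  ∃-common-zero {n} A f g ΣA<
    with any? (λ v → any? (λ w → (A v w ℕ.≟ 0) ×-dec ((f v ℕ.≟ 0) ×-dec (g w ℕ.≟ 0))))
  ... | yes found = found
  ... | no  none  = contradiction ΣA< (ℕ.≤⇒≯ (begin
    (n ∸ sum f) * (n ∸ sum g)                     ≤⟨ ℕ.*-mono-≤ (n∸sum≤zeros f) (n∸sum≤zeros g) ⟩
    sum (zeros f) * sum (zeros g)                 ≡⟨ sum-* (zeros f) (zeros g) ⟩
    sum (λ v → sum (λ w → zeros f v * zeros g w)) ≤⟨ sum-mono (λ v → sum-mono (covered v)) ⟩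
    total A                                       ∎))
    where
    covered : ∀ v w → zeros f v * zeros g w ≤ A v w
    covered v w with f v ℕ.≟ 0 | g w ℕ.≟ 0
    ... | no _     | _        = z≤n
    ... | yes _    | no _     = z≤n
    ... | yes fv≡0 | yes gw≡0 = ℕ.n≢0⇒n>0 (λ Avw≡0 → none (v , w , Avw≡0 , fv≡0 , gw≡0))

  sum-single : (f : Fin n → ℕ) → ∀ i → (∀ {k} → i ≢ k → f k ≡ 0) → sum f ≡ f i
  sum-single {suc n} f i f≡0 = begin-equality
    sum f                       ≡⟨ sum-remove {i = i} f ⟩
    f i + sum (f ∘ punchIn i)   ≡⟨ cong (f i +_) (all-zero⇒sum≡0 _ (λ k → f≡0 (punchInᵢ≢i i k ∘ sym))) ⟩
    f i + 0                     ≡⟨ ℕ.+-identityʳ (f i) ⟩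
    f i                         ∎

  -- Bad pairs

  module _ (f g : Fin n → ℕ) where

    -- Here `f` and `g` stand for the row sums of `B` and `C`. A pair that is not bad has a common
    -- neighbour in the third part.
    Bad : Fin n → Fin n → Set
    Bad v w = n ≤ f v + g w

    bad? : ∀ v w → Dec (Bad v w)
    bad? v w = n ≤? f v + g w

    bad : Matrix n
    bad v w = 𝟙 (bad? v w)

    -- Each bad partner `w` of `v` has `g w` at least n - `f v`, hence at least n - `sum f`.
    sum-bad-row : ∀ v → sum (bad v) * (n ∸ sum f) ≤ sum g
    sum-bad-row v = 𝟙-sum-* (bad? v) λ w b →
      ℕ.m≤n+o⇒m∸n≤o n (sum f) (ℕ.≤-trans b (ℕ.+-monoˡ-≤ (g w) (term≤sum f v)))

    sum-bad-col : ∀ w → sum (λ v → bad v w) * (n ∸ sum g) ≤ sum f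
    sum-bad-col w = 𝟙-sum-* (λ v → bad? v w) λ v b →
      ℕ.m≤n+o⇒m∸n≤o n (sum g) (ℕ.≤-trans b (ℕ.≤-trans
        (ℕ.+-monoʳ-≤ (f v) (term≤sum g w)) (ℕ.≤-reflexive (ℕ.+-comm (f v) (sum g)))))

    -- Two disjoint bad pairs would carry total weight 2n, so the bad pairs
    -- form a star.
    bad-star : sum f + sum g < n + n →
      total bad ≡ 0 ⊎
      (∃[ v ] ∀ {v′} → v ≢ v′ → ∀ w → ¬ Bad v′ w) ⊎
      (∃[ w ] ∀ {w′} → w ≢ w′ → ∀ v → ¬ Bad v w′)
    bad-star Σ<2n with any? (λ v → any? (bad? v))
    ... | no none = inj₁ (all-zero⇒sum≡0 _ (λ v → all-zero⇒sum≡0 (bad v) (λ w →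
            𝟙-no (bad? v w) (λ b → none (v , w , b)))))
    ... | yes (v₀ , w₀ , b₀) with any? (λ v → ¬? (v₀ ≟ v) ×-dec any? (bad? v))
    ...   | no none = inj₂ (inj₁ (v₀ , λ v₀≢v w b → none (_ , v₀≢v , w , b)))
    ...   | yes (v₁ , v₀≢v₁ , w₁ , b₁) = inj₂ (inj₂ (w₀ , only-w₀))
      where
      meet : ∀ {v w v′ w′} → Bad v w → Bad v′ w′ → v ≢ v′ → w ≢ w′ → ⊥
      meet {v} {w} {v′} {w′} b b′ v≢v′ w≢w′ = ℕ.<⇒≱ Σ<2n (begin
        n + n                          ≤⟨ ℕ.+-mono-≤ b b′ ⟩
        (f v + g w) + (f v′ + g w′)    ≡⟨ interchange (f v) (g w) (f v′) (g w′) ⟩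
        (f v + f v′) + (g w + g w′)    ≤⟨ ℕ.+-mono-≤ (two-terms≤sum f v≢v′) (two-terms≤sum g w≢w′) ⟩
        sum f + sum g                  ∎)
        where
        interchange : ∀ a b c d → (a + b) + (c + d) ≡ (a + c) + (b + d)
        interchange = solve-∀

      -- The pairs `b₀` and `b₁` lie in different rows, hence both in column `w₀`. A bad pair in
      -- another column must share row `v₀` with `b₀`, and then it is disjoint from `b₁`.
      only-w₀ : ∀ {w} → w₀ ≢ w → ∀ v → ¬ Bad v w
      only-w₀ {w} w₀≢w v b with v₀ ≟ v | w₀ ≟ w₁
      ... | no v₀≢v  | _         = meet b₀ b v₀≢v w₀≢w
      ... | yes _    | no w₀≢w₁  = meet b₀ b₁ v₀≢v₁ w₀≢w₁
      ... | yes refl | yes refl  = meet b b₁ v₀≢v₁ (w₀≢w ∘ sym)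

    -- All bad pairs lie on one line, so the bound for that line bounds their total number. This is
    -- used with `x` = n - `total A`.
    total-bad< : ∀ {x} → 0 < x → sum f + sum g < n + n →
                 sum g < x * (n ∸ sum f) → sum f < x * (n ∸ sum g) → total bad < x
    total-bad< {x} 0<x Σ<2n Σg< Σf< with bad-star Σ<2n
    ... | inj₁ ≡0 = ℕ.≤-<-trans (ℕ.≤-reflexive ≡0) 0<x
    ... | inj₂ (inj₁ (v , only-v)) = ℕ.*-cancelʳ-< _ _ _ (begin-strict
      total bad * (n ∸ sum f)   ≡⟨ cong (_* (n ∸ sum f)) (sum-single (row bad) v (λ v≢v′ →
                                     all-zero⇒sum≡0 _ (λ w → 𝟙-no (bad? _ w) (only-v v≢v′ w)))) ⟩
      sum (bad v) * (n ∸ sum f) ≤⟨ sum-bad-row v ⟩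
      sum g                     <⟨ Σg< ⟩
      x * (n ∸ sum f)           ∎)
    ... | inj₂ (inj₂ (w , only-w)) = ℕ.*-cancelʳ-< _ _ _ (begin-strict
      total bad * (n ∸ sum g)   ≡⟨ cong (_* (n ∸ sum g)) (∑-comm bad) ⟩
      sum (col bad) * (n ∸ sum g)
                                ≡⟨ cong (_* (n ∸ sum g)) (sum-single (col bad) w (λ w≢w′ →
                                     all-zero⇒sum≡0 _ (λ v → 𝟙-no (bad? v _) (only-w w≢w′ v)))) ⟩
      col bad w * (n ∸ sum g)   ≤⟨ sum-bad-col w ⟩
      sum f                     <⟨ Σf< ⟩
      x * (n ∸ sum g)           ∎)

  -- The cases of the matching theorem

  col≤total : (M : Matrix n) → ∀ j → col M j ≤ total M
  col≤total M j = sum-mono (λ i → term≤sum (M i) j)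

  -- Deleting a triangle through `z` removes at least n non-edges from `B` and `C` together, which
  -- makes the rest sparse.
  heavy-vertex-matching : (A B C : Matrix n) → ∀ z → n ≤ col B z + col C z →
    total A + 2 ≤ n → total B + total C + 3 ≤ n + n →
    total A < (n ∸ total B) * (n ∸ total C) → TriangleMatching A B C
  heavy-vertex-matching {suc n} A B C z n≤ ΣA≤ ΣBC≤ ΣA<
    -- The columns of `z` weigh at most `total B` and `total C`, so `z` has enough neighbours on
    -- both sides for two of them to be adjacent.
    with v , w , Avw≡0 , Bvz≡0 , Cwz≡0 ← ∃-common-zero A (λ v → B v z) (λ w → C w z)
           (ℕ.<-≤-trans ΣA<
             (ℕ.*-mono-≤ (ℕ.∸-monoʳ-≤ (suc n) (col≤total B z)) (ℕ.∸-monoʳ-≤ (suc n) (col≤total C z)))) =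
    extend-triangle A B C Avw≡0 Bvz≡0 Cwz≡0
      (sparse-triangle-matching _ _ _ A′-sparse BC′-sparse)
    where
    A′-sparse : total (minor A v w) ≤ n ∸ 1
    -- Deleting `v` and `w` may remove no non-edge of `A`; the margin of two absorbs the loss of
    -- size.
    A′-sparse = ℕ.∸-monoˡ-≤ {m = 1 + total (minor A v w)} 1 (ℕ.+-cancelʳ-≤ 1 _ _ (begin
      1 + total (minor A v w) + 1   ≤⟨ ℕ.+-monoˡ-≤ 1 (ℕ.+-monoʳ-≤ 1 (total-minor≤ A v w)) ⟩
      1 + total A + 1               ≡⟨ lemma (total A) ⟩
      total A + 2                   ≤⟨ ΣA≤ ⟩
      suc n                         ≡⟨ ℕ.+-comm 1 n ⟩
      n + 1                         ∎))
      where
      lemma : ∀ a → 1 + a + 1 ≡ a + 2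
      lemma = solve-∀

    minor-col : (M : Matrix (suc n)) → ∀ {v} → M v z ≡ 0 → col M z + total (minor M v z) ≤ total M
    minor-col M {v} Mvz≡0 = begin
      col M z + total (minor M v z)             ≤⟨ ℕ.+-monoˡ-≤ _ (ℕ.m≤n+m (col M z) (row M v)) ⟩
      row M v + col M z + total (minor M v z)   ≡⟨ total-minor M Mvz≡0 ⟨
      total M                                   ∎

    BC′-sparse : total (minor B v z) + total (minor C w z) ≤ n ∸ 1
    BC′-sparse = ℕ.∸-monoˡ-≤ {m = 1 + (b′ + c′)} 1 (ℕ.+-cancelʳ-≤ (2 + suc n) _ _ (begin
      1 + (b′ + c′) + (2 + suc n)               ≤⟨ ℕ.+-monoʳ-≤ (1 + (b′ + c′)) (ℕ.+-monoʳ-≤ 2 n≤) ⟩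
      1 + (b′ + c′) + (2 + (bz + cz))           ≡⟨ rearrange b′ c′ bz cz ⟩
      (bz + b′) + (cz + c′) + 3                 ≤⟨ ℕ.+-monoˡ-≤ 3 (ℕ.+-mono-≤ (minor-col B Bvz≡0) (minor-col C Cwz≡0)) ⟩
      total B + total C + 3                     ≤⟨ ΣBC≤ ⟩
      -- The estimate has one unit to spare, given away here so that `2 + suc n` cancels.
      suc n + suc n                             ≤⟨ ℕ.+-monoˡ-≤ (suc n) (ℕ.m≤n+m (suc n) 1) ⟩
      2 + n + suc n                             ≡⟨ shift n ⟩
      n + (2 + suc n)                           ∎))
      where
      b′ = total (minor B v z)
      c′ = total (minor C w z)
      bz = col B z
      cz = col C z

      rearrange : ∀ b′ c′ bz cz → 1 + (b′ + c′) + (2 + (bz + cz)) ≡ (bz + b′) + (cz + c′) + 3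
      rearrange = solve-∀

      shift : ∀ n → 2 + n + suc n ≡ n + (2 + suc n)
      shift = solve-∀

  -- Matching the first two parts without bad pairs puts a zero into every row of the contraction,
  -- and `light` puts one into every column.
  light-vertices-matching : (A B C : Matrix n) → (∀ z → col B z + col C z < n) →
    total A < n → total B + total C + 3 ≤ n + n →
    total C < (n ∸ total A) * (n ∸ total B) → total B < (n ∸ total A) * (n ∸ total C) →
    TriangleMatching A B C
  light-vertices-matching {n} A B C light ΣA< ΣBC≤ ΣC< ΣB<
    -- A zero of this sum is an edge that is not a bad pair. There are fewer than n - `total A` bad
    -- pairs, so the total stays below n.
    with σ , A+bad≡0 ← sparse-matching (λ v w → A v w + bad (row B) (row C) v w)
                         (ℕ.∸-monoˡ-≤ 1 (begin-strict
           total (λ v w → A v w + bad (row B) (row C) v w)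
             ≡⟨ trans (sum-cong-≗ (λ v → ∑-distrib-+ (A v) _)) (∑-distrib-+ (row A) _) ⟩
           total A + total (bad (row B) (row C))
             <⟨ ℕ.+-monoʳ-< (total A) (total-bad< (row B) (row C) (ℕ.m<n⇒0<n∸m ΣA<)
                                         (ℕ.<-≤-trans (ℕ.m<m+n _ (s≤s z≤n)) ΣBC≤) ΣC< ΣB<) ⟩
           total A + (n ∸ total A)
             ≡⟨ ℕ.m+[n∸m]≡n (ℕ.<⇒≤ ΣA<) ⟩
           n ∎)) =
    combine A B C σ (λ k → ℕ.m+n≡0⇒m≡0 _ (A+bad≡0 k))
      (semi-sparse-matching (contract σ B C)
        (ℕ.≤-trans (ℕ.≤-reflexive (cong (_+ 3) (total-contract σ B C))) ΣBC≤)
        (λ k → sum<n⇒∃-zero (contract σ B C k) (begin-strict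
          row (contract σ B C) k              ≡⟨ row-contract σ B C k ⟩
          row B k + row C (σ ⟨$⟩ʳ k)          <⟨ ℕ.≰⇒> (𝟙≡0⇒¬ (bad? (row B) (row C) k (σ ⟨$⟩ʳ k))
                                                         (ℕ.m+n≡0⇒n≡0 (A k (σ ⟨$⟩ʳ k)) (A+bad≡0 k))) ⟩
          n                                   ∎))
        (λ z → sum<n⇒∃-zero (λ k → contract σ B C k z) (begin-strict
          col (contract σ B C) z              ≡⟨ col-contract σ B C z ⟩
          col B z + col C z                   <⟨ light z ⟩
          n                                   ∎)))

  -- For a = n - 1 the product is just n - b.
  saturated : ∀ {a b c} → suc a ≡ n → b < n → c < (n ∸ a) * (n ∸ b) → b + c ≤ n ∸ 1
  saturated {a = a} {b} {c} refl (s≤s b≤a) c< = s≤s⁻¹ (begin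
    suc (b + c)                             ≡⟨ ℕ.+-suc b c ⟨
    b + suc c                               ≤⟨ ℕ.+-monoʳ-≤ b c< ⟩
    b + (suc a ∸ a) * (suc a ∸ b)           ≡⟨ cong (λ x → b + x * (suc a ∸ b)) (ℕ.m+n∸n≡m 1 a) ⟩
    b + 1 * (suc a ∸ b)                     ≡⟨ cong (b +_) (ℕ.*-identityˡ (suc a ∸ b)) ⟩
    b + (suc a ∸ b)                         ≡⟨ ℕ.m+[n∸m]≡n (ℕ.m≤n⇒m≤1+n b≤a) ⟩
    suc a                                   ∎)

  +2≤n : ∀ {x} → x < n → suc x ≢ n → x + 2 ≤ n
  +2≤n {x = x} x<n 1+x≢n = ℕ.≤-trans (ℕ.≤-reflexive (ℕ.+-comm x 2)) (ℕ.≤∧≢⇒< x<n 1+x≢n)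

  sum+3≤2n : ∀ {b c} → b < n → suc b ≢ n → c < n → b + c + 3 ≤ n + n
  sum+3≤2n {n} {b} {c} b<n 1+b≢n c<n = begin
    b + c + 3          ≡⟨ lemma b c ⟩
    (b + 2) + suc c    ≤⟨ ℕ.+-mono-≤ (+2≤n b<n 1+b≢n) c<n ⟩
    n + n              ∎
    where
    lemma : ∀ b c → b + c + 3 ≡ (b + 2) + suc c
    lemma = solve-∀

  -- Setting aside `total A` = n - 1 and `total B` = n - 1 gains the margins that the remaining
  -- cases draw on.
  triangle-matching : (A B C : Matrix n) → total A < n → total B < n → total C < n →
    total C < (n ∸ total A) * (n ∸ total B) →
    total A < (n ∸ total B) * (n ∸ total C) →
    total B < (n ∸ total A) * (n ∸ total C) →
    TriangleMatching A B C
  triangle-matching {n} A B C ΣA< ΣB< ΣC< ΣC<AB ΣA<BC ΣB<AC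
    with suc (total A) ℕ.≟ n | suc (total B) ℕ.≟ n
  ... | yes a+1≡n | _ =
    sparse-triangle-matching A B C (ℕ.∸-monoˡ-≤ 1 ΣA<) (saturated a+1≡n ΣB< ΣC<AB)
  ... | no _ | yes b+1≡n = swap-parts {A = A} {B} {C}
    (sparse-triangle-matching B A (flip C) (ℕ.∸-monoˡ-≤ 1 ΣB<) (begin
      total A + total (flip C)   ≡⟨ cong (total A +_) (∑-comm C) ⟨
      total A + total C          ≡⟨ ℕ.+-comm (total A) (total C) ⟩
      total C + total A          ≤⟨ saturated b+1≡n ΣC< ΣA<BC ⟩
      n ∸ 1                      ∎))
  ... | no a+1≢n | no b+1≢n with any? (λ z → n ≤? col B z + col C z)
  ...   | yes (z , n≤) = heavy-vertex-matching A B C z n≤ (+2≤n ΣA< a+1≢n) (sum+3≤2n ΣB< b+1≢n ΣC<) ΣA<BC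
  ...   | no none = light-vertices-matching A B C (λ z → ℕ.≰⇒> (λ n≤ → none (z , n≤)))
                    ΣA< (sum+3≤2n ΣB< b+1≢n ΣC<) ΣC<AB ΣB<AC

-- Identities in commutative rings

module RingIdentities {c ℓ} (R : CommutativeRing c ℓ) where

  private
    ring : AlmostCommutativeRing c ℓ
    -- Equality is not assumed decidable, so the zero test never succeeds. The identities below
    -- involve no cancellation of terms.
    ring = fromCommutativeRing R (λ _ → nothing)

  open AlmostCommutativeRing ring

  *-interchange : ∀ a b u v → a * b * (u * v) ≈ (a * u) * (b * v)
  *-interchange = RingSolver.solve-∀ ring

  +-regroup : ∀ p q x y → p + (q + (x + y)) ≈ p + q + x + y
  +-regroup = RingSolver.solve-∀ ring

  -- The expansion of xy = ((x + p) - p)((y + q) - q), with the negative terms moved to the left.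
  expand-complement : ∀ x y p q → x * y + (p * (y + q) + (x + p) * q) ≈ (x + p) * (y + q) + p * q
  expand-complement = RingSolver.solve-∀ ring

-- Order and powers in the real field

module RealProperties {c ℓ₁ ℓ₂ ℓ₃} (ℝ : Reals c ℓ₁ ℓ₂ ℓ₃) where

  open Reals ℝ hiding (zero)
  open IsStrictPartialOrder isStrictPartialOrder using (irrefl; <-respˡ-≈; <-respʳ-≈; asym)
    renaming (trans to <-trans)
  open CommutativeRing commutativeRing using (ring)
  open import Algebra.Properties.Ring ring using (-‿distribˡ-*; -‿distribʳ-*; -‿involutive; +-cancelˡ)
  open import Algebra.Properties.Semiring.Mult semiring using (×-homo-+; ×1-homo-*)
  open import Algebra.Apartness.Properties.HeytingCommutativeRing heytingCommutativeRing
    using (1#0; x-0≈x; invertibleˡ⇒#)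
  open RingIdentities commutativeRing
  open import Relation.Binary.Reasoning.Setoid setoid

  x<0⇒0<-x : ∀ {x} → x < 0# → 0# < - x
  x<0⇒0<-x {x} x<0 = <-respˡ-≈ (-‿inverseʳ x) (<-respʳ-≈ (+-identityˡ _) (+-monoˡ-< (- x) x<0))

  x+y-y≈x : ∀ x y → (x + y) - y ≈ x
  x+y-y≈x x y = begin
    (x + y) - y   ≈⟨ +-assoc x y (- y) ⟩
    x + (y - y)   ≈⟨ +-congˡ (-‿inverseʳ y) ⟩
    x + 0#        ≈⟨ +-identityʳ x ⟩
    x             ∎

  +-cancelʳ-< : ∀ {x y} z → x + z < y + z → x < y
  +-cancelʳ-< z x+z<y+z =
    <-respˡ-≈ (x+y-y≈x _ z) (<-respʳ-≈ (x+y-y≈x _ z) (+-monoˡ-< (- z) x+z<y+z))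

  +-pos : ∀ {x y} → 0# < x → 0# < y → 0# < x + y
  +-pos {x} {y} 0<x 0<y = <-trans 0<y (<-respˡ-≈ (+-identityˡ y) (+-monoˡ-< y 0<x))

  *-monoˡ-< : ∀ {x y} z → 0# < z → x < y → x * z < y * z
  *-monoˡ-< {x} {y} z 0<z x<y = +-cancelʳ-< (- (x * z)) (<-respˡ-≈ (sym (-‿inverseʳ (x * z)))
    (<-respʳ-≈ (trans (distribʳ z y (- x)) (+-congˡ (sym (-‿distribˡ-* x z))))
      (*-pos (<-respˡ-≈ (-‿inverseʳ x) (+-monoˡ-< (- x) x<y)) 0<z)))

  square-pos : ∀ {x} → x # 0# → 0# < x * x
  square-pos {x} x#0 with Equivalence.to #⇔<⊎> x#0
  ... | inj₂ 0<x = *-pos 0<x 0<x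
  ... | inj₁ x<0 = <-respʳ-≈ -x*-x≈x*x (*-pos (x<0⇒0<-x x<0) (x<0⇒0<-x x<0))
    where
    -x*-x≈x*x : - x * - x ≈ x * x
    -x*-x≈x*x = begin
      - x * - x       ≈⟨ -‿distribˡ-* x (- x) ⟨
      - (x * - x)     ≈⟨ -‿cong (-‿distribʳ-* x x) ⟨
      - - (x * x)     ≈⟨ -‿involutive (x * x) ⟩
      x * x           ∎

  0<1 : 0# < 1#
  0<1 = <-respʳ-≈ (*-identityˡ 1#) (square-pos 1#0)

  unit#0 : ∀ {x y} → x * y ≈ 1# → x # 0#
  unit#0 {x} {y} xy≈1 = invertibleˡ⇒# (y , trans (*-congˡ (x-0≈x x)) (trans (*-comm y x) xy≈1))

  pos⇒invertible : ∀ {x} → 0# < x → ∃[ y ] x * y ≈ 1#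
  pos⇒invertible {x} 0<x with y , _ , xy≈1 ← #⇒invertible (Equivalence.from #⇔<⊎> (inj₂ 0<x)) =
    y , trans (*-congʳ (sym (x-0≈x x))) xy≈1

  fromℕ-+ : ∀ i j → fromℕ (i ℕ.+ j) ≈ fromℕ i + fromℕ j
  fromℕ-+ = ×-homo-+ 1#

  fromℕ-* : ∀ i j → fromℕ (i ℕ.* j) ≈ fromℕ i * fromℕ j
  fromℕ-* = ×1-homo-*

  fromℕ-suc-pos : ∀ i → 0# < fromℕ (suc i)
  fromℕ-suc-pos zero    = <-respʳ-≈ (sym (+-identityʳ 1#)) 0<1
  fromℕ-suc-pos (suc i) = +-pos 0<1 (fromℕ-suc-pos i)

  fromℕ-mono-< : ∀ {i j} → i ℕ.< j → fromℕ i < fromℕ j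
  fromℕ-mono-< {i} i<j with k , ≡.refl ← ℕ.m≤n⇒∃[o]m+o≡n i<j =
    <-respˡ-≈ (+-identityˡ _) (<-respʳ-≈
      (trans (sym (fromℕ-+ (suc k) i)) (reflexive (≡.cong (fromℕ ∘ suc) (ℕ.+-comm k i))))
      (+-monoˡ-< (fromℕ i) (fromℕ-suc-pos k)))

  -- Trichotomy on ℕ does the work, so none is needed on the reals.
  fromℕ-cancel-< : ∀ {i j} → fromℕ i < fromℕ j → i ℕ.< j
  fromℕ-cancel-< {i} {j} i<j with i ℕ.<? j
  ... | yes p = p
  ... | no i≮j with ℕ.m≤n⇒m<n∨m≡n (ℕ.≮⇒≥ i≮j)
  ...   | inj₁ j<i    = contradiction (fromℕ-mono-< j<i) (asym i<j)
  ...   | inj₂ ≡.refl = contradiction i<j (irrefl refl)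

  module Power (n : ℕ) .{{_ : ℕ.NonZero n}} where

    private N = fromℕ n

    N-pos : 0# < N
    N-pos = ≡.subst (λ m → 0# < fromℕ m) (ℕ.suc-pred n) (fromℕ-suc-pos (ℕ.pred n))

    -- Equal exponents are `≤` each other, so by monotonicity neither power lies below the other;
    -- tightness of apartness then makes them equal.
    ^-congʳ : ∀ {x y} → x ≈ y → n ^ x ≈ n ^ y
    ^-congʳ {x} {y} x≈y = proj₁ (tight _ _) λ nˣ#nʸ →
      [ ^-monoʳ-≤ n (irrefl x≈y) , ^-monoʳ-≤ n (irrefl (sym x≈y)) ]′ (Equivalence.to #⇔<⊎> nˣ#nʸ)

    n^[x-1]*n≈n^x : ∀ x → n ^ (x - 1#) * N ≈ n ^ x
    n^[x-1]*n≈n^x x = begin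
      n ^ (x - 1#) * N         ≈⟨ *-congˡ (^-identityʳ n) ⟨
      n ^ (x - 1#) * n ^ 1#    ≈⟨ ^-homo-+ n (x - 1#) 1# ⟨
      n ^ (x - 1# + 1#)        ≈⟨ ^-congʳ x-1+1≈x ⟩
      n ^ x                    ∎
      where
      x-1+1≈x : x - 1# + 1# ≈ x
      x-1+1≈x = trans (+-assoc x (- 1#) 1#) (trans (+-congˡ (-‿inverseˡ 1#)) (+-identityʳ x))

    -- Multiplying by `n ^ 0#` fixes the invertible element `N`.
    n^0≈1 : n ^ 0# ≈ 1#
    n^0≈1 with y , Ny≈1 ← pos⇒invertible N-pos = begin
      n ^ 0#               ≈⟨ *-identityʳ _ ⟨
      n ^ 0# * 1#          ≈⟨ *-congˡ Ny≈1 ⟨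
      n ^ 0# * (N * y)     ≈⟨ *-assoc _ N y ⟨
      n ^ 0# * N * y       ≈⟨ *-congʳ n^0*N≈N ⟩
      N * y                ≈⟨ Ny≈1 ⟩
      1#                   ∎
      where
      n^0*N≈N : n ^ 0# * N ≈ N
      n^0*N≈N = begin
        n ^ 0# * N           ≈⟨ *-congˡ (^-identityʳ n) ⟨
        n ^ 0# * n ^ 1#      ≈⟨ ^-homo-+ n 0# 1# ⟨
        n ^ (0# + 1#)        ≈⟨ ^-congʳ (+-identityˡ 1#) ⟩
        n ^ 1#               ≈⟨ ^-identityʳ n ⟩
        N                    ∎

    n^x*n^-x≈1 : ∀ x → n ^ x * n ^ (- x) ≈ 1#
    n^x*n^-x≈1 x = trans (sym (^-homo-+ n x (- x))) (trans (^-congʳ (-‿inverseʳ x)) n^0≈1)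

    -- The power is the square of `n ^ (t * x)` with `t` one half, and that root is a unit, hence
    -- apart from zero.
    n^x-pos : ∀ x → 0# < n ^ x
    n^x-pos x with t , 2t≈1 ← pos⇒invertible (+-pos 0<1 0<1) =
      <-respʳ-≈ (trans (sym (^-homo-+ n (t * x) (t * x))) (^-congʳ h+h≈x))
        (square-pos (unit#0 (n^x*n^-x≈1 (t * x))))
      where
      h+h≈x : t * x + t * x ≈ x
      h+h≈x = begin
        t * x + t * x               ≈⟨ +-cong (*-identityˡ _) (*-identityˡ _) ⟨
        1# * (t * x) + 1# * (t * x) ≈⟨ distribʳ (t * x) 1# 1# ⟨
        (1# + 1#) * (t * x)         ≈⟨ *-assoc _ t x ⟨
        (1# + 1#) * t * x           ≈⟨ *-congʳ 2t≈1 ⟩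
        1# * x                      ≈⟨ *-identityˡ x ⟩
        x                           ∎

    α*n^x<0⇒α<0 : ∀ {α} x → α * n ^ x < 0# → α < 0#
    α*n^x<0⇒α<0 {α} x αnˣ<0 =
      <-respˡ-≈ α*n^x*n^-x≈α (<-respʳ-≈ (zeroˡ _) (*-monoˡ-< (n ^ (- x)) (n^x-pos (- x)) αnˣ<0))
      where
      α*n^x*n^-x≈α : α * n ^ x * n ^ (- x) ≈ α
      α*n^x*n^-x≈α = trans (*-assoc α _ _) (trans (*-congˡ (n^x*n^-x≈1 x)) (*-identityʳ α))

    -- Multiplying by n rewrites the hypothesis in terms of the excesses of the edge counts over n²
    -- - n: XY + Z > n.
    scale : ∀ α β γ δa δb δc → α * β * n ^ (δa + δb - 1#) + γ * n ^ (δc - 1#) > 1# →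
            (α * n ^ δa) * (β * n ^ δb) + γ * n ^ δc > N
    scale α β γ δa δb δc 1< =
      <-respˡ-≈ (*-identityˡ N) (<-respʳ-≈ scaled (*-monoˡ-< N N-pos 1<))
      where
      scaled : (α * β * n ^ (δa + δb - 1#) + γ * n ^ (δc - 1#)) * N
             ≈ (α * n ^ δa) * (β * n ^ δb) + γ * n ^ δc
      scaled = begin
        (α * β * n ^ (δa + δb - 1#) + γ * n ^ (δc - 1#)) * N
          ≈⟨ distribʳ N _ _ ⟩
        α * β * n ^ (δa + δb - 1#) * N + γ * n ^ (δc - 1#) * N
          ≈⟨ +-cong (*-assoc (α * β) _ N) (*-assoc γ _ N) ⟩
        α * β * (n ^ (δa + δb - 1#) * N) + γ * (n ^ (δc - 1#) * N)
          ≈⟨ +-cong (*-congˡ (n^[x-1]*n≈n^x (δa + δb))) (*-congˡ (n^[x-1]*n≈n^x δc)) ⟩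
        α * β * n ^ (δa + δb) + γ * n ^ δc
          ≈⟨ +-congʳ (*-congˡ (^-homo-+ n δa δb)) ⟩
        α * β * (n ^ δa * n ^ δb) + γ * n ^ δc
          ≈⟨ +-congʳ (*-interchange α β _ _) ⟩
        (α * n ^ δa) * (β * n ^ δb) + γ * n ^ δc ∎

  -- Compare e + a = n² with e = n² - n + X: the excess is n - a.
  excess+missing≈n : ∀ e a n {X} → e ℕ.+ a ≡ n ℕ.* n →
    fromℕ e ≈ fromℕ n * fromℕ n - fromℕ n + X → X + fromℕ a ≈ fromℕ n
  excess+missing≈n e a n {X} e+a≡n² e≈ = begin
    X + fromℕ a                    ≈⟨ +-identityˡ _ ⟨
    0# + (X + fromℕ a)             ≈⟨ +-congʳ (-‿inverseʳ N) ⟨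
    N - N + (X + fromℕ a)          ≈⟨ +-assoc N (- N) _ ⟩
    N + (- N + (X + fromℕ a))      ≈⟨ +-congˡ cancelled ⟩
    N + 0#                         ≈⟨ +-identityʳ N ⟩
    N                              ∎
    where
    N = fromℕ n

    cancelled : - N + (X + fromℕ a) ≈ 0#
    cancelled = +-cancelˡ (N * N) _ _ (begin
      N * N + (- N + (X + fromℕ a))   ≈⟨ +-regroup (N * N) (- N) X (fromℕ a) ⟩
      N * N - N + X + fromℕ a         ≈⟨ +-congʳ e≈ ⟨
      fromℕ e + fromℕ a               ≈⟨ fromℕ-+ e a ⟨
      fromℕ (e ℕ.+ a)                 ≡⟨ ≡.cong fromℕ e+a≡n² ⟩
      fromℕ (n ℕ.* n)                 ≈⟨ fromℕ-* n n ⟩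
      N * N                           ≈⟨ +-identityʳ _ ⟨
      N * N + 0#                      ∎)

  excess-neg : ∀ n a {X} → X + fromℕ a ≈ fromℕ n → n ℕ.< a → X < 0#
  excess-neg n a X+a≈n n<a = +-cancelʳ-< (fromℕ a)
    (<-respˡ-≈ (sym X+a≈n) (<-respʳ-≈ (sym (+-identityˡ _)) (fromℕ-mono-< n<a)))

  -- With X = n - a, Y = n - b and Z = n - c, the hypothesis says c < (n - a)(n - b). It is stated
  -- without subtraction so that it can be read off in ℕ, where some of these differences may be
  -- negative.
  missing-inequality : ∀ n a b c {X Y Z} →
    X + fromℕ a ≈ fromℕ n → Y + fromℕ b ≈ fromℕ n → Z + fromℕ c ≈ fromℕ n →
    X * Y + Z > fromℕ n → c ℕ.+ (a ℕ.* n ℕ.+ n ℕ.* b) ℕ.< n ℕ.* n ℕ.+ a ℕ.* b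
  missing-inequality n a b c {X} {Y} {Z} X+a≈n Y+b≈n Z+c≈n n<XY+Z =
    fromℕ-cancel-< (<-respˡ-≈ lhs (<-respʳ-≈ rhs (+-monoˡ-< (A * N + N * B) c<XY)))
    where
    N = fromℕ n
    A = fromℕ a
    B = fromℕ b
    C = fromℕ c

    c<XY : C < X * Y
    -- Adding `C` turns `Z + C` into `N`, which then cancels.
    c<XY = +-cancelʳ-< N (<-respˡ-≈ (+-comm N C) (<-respʳ-≈ XY+Z+C≈XY+N (+-monoˡ-< C n<XY+Z)))
      where
      XY+Z+C≈XY+N : X * Y + Z + C ≈ X * Y + N
      XY+Z+C≈XY+N = trans (+-assoc _ Z C) (+-congˡ Z+c≈n)

    fromℕ-products : ∀ i j k l → fromℕ (i ℕ.* j ℕ.+ k ℕ.* l) ≈ fromℕ i * fromℕ j + fromℕ k * fromℕ l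
    fromℕ-products i j k l = trans (fromℕ-+ (i ℕ.* j) (k ℕ.* l)) (+-cong (fromℕ-* i j) (fromℕ-* k l))

    lhs : C + (A * N + N * B) ≈ fromℕ (c ℕ.+ (a ℕ.* n ℕ.+ n ℕ.* b))
    lhs = trans (+-congˡ (sym (fromℕ-products a n n b))) (sym (fromℕ-+ c _))

    rhs : X * Y + (A * N + N * B) ≈ fromℕ (n ℕ.* n ℕ.+ a ℕ.* b)
    rhs = begin
      X * Y + (A * N + N * B)               ≈⟨ +-congˡ (+-cong (*-congˡ Y+b≈n) (*-congʳ X+a≈n)) ⟨
      X * Y + (A * (Y + B) + (X + A) * B)   ≈⟨ expand-complement X Y A B ⟩
      (X + A) * (Y + B) + A * B             ≈⟨ +-congʳ (*-cong X+a≈n Y+b≈n) ⟩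
      N * N + A * B                         ≈⟨ fromℕ-products n n a b ⟨
      fromℕ (n ℕ.* n ℕ.+ a ℕ.* b)           ∎

-- Counting non-edges and splitting by sign in ℕ

module Counting where

  open import Data.Nat using (_+_; _*_; _∸_; _≤_; _<_)
  open Matchings using (𝟙)
  open import Algebra.Properties.Semiring.Sum ℕ.+-*-semiring using (sum)
  open ≡ using (refl; sym; trans; cong; cong₂)
  open ≡.≡-Reasoning
  open ℕ-RingSolver using (solve-∀)

  length-filter-tabulate : ∀ {A : Set} {P : Pred A 0ℓ} (P? : Decidable P) (f : Fin m → A) →
    length (filter P? (tabulate f)) + sum (λ i → 𝟙 (¬? (P? (f i)))) ≡ m
  length-filter-tabulate {m = zero}  P? f = refl
  length-filter-tabulate {m = suc m} P? f with ih ← length-filter-tabulate P? (f ∘ suc) | P? (f zero)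
  ... | yes _ = cong suc ih
  ... | no  _ = trans (ℕ.+-suc _ _) (cong suc ih)

  length-filter-cartesianProduct : ∀ {A B : Set} {P : Pred (A × B) 0ℓ} (P? : Decidable P)
    (f : Fin m → A) (g : Fin n → B) →
    length (filter P? (cartesianProduct (tabulate f) (tabulate g)))
      + sum (λ i → sum (λ j → 𝟙 (¬? (P? (f i , g j))))) ≡ m * n
  length-filter-cartesianProduct {m = zero}  P? f g = refl
  length-filter-cartesianProduct {m = suc m} {n = n} P? f g = begin
    length (filter P? (List.map (f zero ,_) (tabulate g) List.++ rest)) + (s₀ + s)
      ≡⟨ cong (λ xs → length xs + (s₀ + s)) (List.filter-++ P? (List.map (f zero ,_) (tabulate g)) rest) ⟩
    length (filter P? (List.map (f zero ,_) (tabulate g)) List.++ filter P? rest) + (s₀ + s)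
      ≡⟨ cong (_+ (s₀ + s)) (List.length-++ (filter P? (List.map (f zero ,_) (tabulate g)))) ⟩
    length (filter P? (List.map (f zero ,_) (tabulate g))) + l + (s₀ + s)
      ≡⟨ cong (λ xs → length (filter P? xs) + l + (s₀ + s)) (List.map-tabulate g (f zero ,_)) ⟩
    l₀ + l + (s₀ + s)
      ≡⟨ interchange l₀ l s₀ s ⟩
    (l₀ + s₀) + (l + s)
      ≡⟨ cong₂ _+_ (length-filter-tabulate P? (λ j → f zero , g j))
                   (length-filter-cartesianProduct P? (f ∘ suc) g) ⟩
    n + m * n ∎
    where
    rest = cartesianProduct (tabulate (f ∘ suc)) (tabulate g)
    l₀ = length (filter P? (tabulate (λ j → f zero , g j)))
    l  = length (filter P? rest)
    s₀ = sum (λ j → 𝟙 (¬? (P? (f zero , g j))))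
    s  = sum (λ i → sum (λ j → 𝟙 (¬? (P? (f (suc i) , g j)))))

    interchange : ∀ a b c d → (a + b) + (c + d) ≡ (a + c) + (b + d)
    interchange = solve-∀

  -- This is (n - a)(n - b) ≤ 0. Writing b = n + q reduces it to aq ≤ nq.
  mixed-sign : ∀ {a b n} → a ≤ n → n ≤ b → n * n + a * b ≤ a * n + n * b
  mixed-sign {a} {n = n} a≤n n≤b with q , refl ← ℕ.m≤n⇒∃[o]m+o≡n n≤b =
    ℕ.≤-trans (ℕ.≤-reflexive (left a n q))
      (ℕ.≤-trans (ℕ.+-monoʳ-≤ (a * n + n * n) (ℕ.*-monoˡ-≤ q a≤n)) (ℕ.≤-reflexive (right a n q)))
    where
    left : ∀ a n q → n * n + a * (n + q) ≡ a * n + n * n + a * q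
    left = solve-∀

    right : ∀ a n q → a * n + n * n + n * q ≡ a * n + n * (n + q)
    right = solve-∀

  -- The hypothesis says c < (n - a)(n - b) over ℤ, with all terms moved to
  -- their positive side.
  complement-split : ∀ a b c n → c + (a * n + n * b) < n * n + a * b →
    (a < n × b < n × c < (n ∸ a) * (n ∸ b)) ⊎ (n < a × n < b)
  complement-split a b c n c< with a ℕ.≤? n | b ℕ.≤? n
  ... | no a≰n | no b≰n = inj₂ (ℕ.≰⇒> a≰n , ℕ.≰⇒> b≰n)
  ... | yes a≤n | no b≰n =
    contradiction (ℕ.≤-trans (mixed-sign a≤n (ℕ.≰⇒≥ b≰n)) (ℕ.m≤n+m _ c)) (ℕ.<⇒≱ c<)
  ... | no a≰n | yes b≤n =
    contradiction (ℕ.≤-trans mixed-sign′ (ℕ.m≤n+m _ c)) (ℕ.<⇒≱ c<)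
    where
    flip-sum : ∀ a b n → b * n + n * a ≡ a * n + n * b
    flip-sum = solve-∀

    mixed-sign′ : n * n + a * b ≤ a * n + n * b
    mixed-sign′ = ≡.subst₂ _≤_ (cong (n * n +_) (ℕ.*-comm b a)) (flip-sum a b n)
                    (mixed-sign b≤n (ℕ.≰⇒≥ a≰n))
  ... | yes a≤n | yes b≤n = inj₁
    -- The product exceeds `c`, so neither factor vanishes and both inequalities are strict.
    ( ℕ.m∸n≢0⇒n<m (λ p≡0 → ℕ.m<n⇒n≢0 c<pq (cong (_* (n ∸ b)) p≡0))
    , ℕ.m∸n≢0⇒n<m (λ q≡0 → ℕ.m<n⇒n≢0 c<pq (trans (cong ((n ∸ a) *_) q≡0) (ℕ.*-zeroʳ (n ∸ a))))
    , c<pq )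
    where
    expand : ∀ p q a b → p * q + (a * (q + b) + (p + a) * b) ≡ (p + a) * (q + b) + a * b
    expand = solve-∀

    c<pq : c < (n ∸ a) * (n ∸ b)
    c<pq = ℕ.+-cancelʳ-< (a * n + n * b) c _ (ℕ.<-≤-trans c< (ℕ.≤-reflexive (sym
      (≡.subst₂ (λ x y → (n ∸ a) * (n ∸ b) + (a * y + x * b) ≡ x * y + a * b)
        (ℕ.m∸n+n≡m a≤n) (ℕ.m∸n+n≡m b≤n) (expand (n ∸ a) (n ∸ b) a b)))))

-- From matrices back to the graph

module _ (G : TripartiteGraph n) where

  open TripartiteGraph G
  open Matchings

  nonEdges : Fin 3 → Fin 3 → Matrix n
  nonEdges i j x y = 𝟙 (¬? (adj? (i , x) (j , y)))

  edgeCount+nonEdges : ∀ i j → edgeCount G i j ℕ.+ total (nonEdges i j) ≡ n ℕ.* n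
  edgeCount+nonEdges i j =
    Counting.length-filter-cartesianProduct (λ (x , y) → adj? (i , x) (j , y)) id id

  triangleMatching⇒factor :
    TriangleMatching (nonEdges 0F 1F) (nonEdges 0F 2F) (nonEdges 1F 2F) → TriangleFactor G
  triangleMatching⇒factor (σ , τ , zero-στ) = (λ k → vertex k , adjacent k) , disjoint
    where
    ρ : Fin 3 → Permutation′ n
    ρ 0F = Perm.id
    ρ 1F = σ
    ρ 2F = τ

    vertex : Fin n → Fin 3 → Vertex n
    vertex k i = i , ρ i ⟨$⟩ʳ k

    edge : ∀ {i j x y} → nonEdges i j x y ≡ 0 → Adj (i , x) (j , y)
    edge {i} {j} {x} {y} ≡0 =
      decidable-stable (adj? (i , x) (j , y)) (𝟙≡0⇒¬ (¬? (adj? (i , x) (j , y))) ≡0)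

    adjacent : ∀ k {i j} → i ≢ j → Adj (vertex k i) (vertex k j)
    adjacent k {0F} {0F} i≢i = contradiction ≡.refl i≢i
    adjacent k {0F} {1F} _   = edge (proj₁ (zero-στ k))
    adjacent k {0F} {2F} _   = edge (proj₁ (proj₂ (zero-στ k)))
    adjacent k {1F} {0F} _   = adj-sym (edge (proj₁ (zero-στ k)))
    adjacent k {1F} {1F} i≢i = contradiction ≡.refl i≢i
    adjacent k {1F} {2F} _   = edge (proj₂ (proj₂ (zero-στ k)))
    adjacent k {2F} {0F} _   = adj-sym (edge (proj₁ (proj₂ (zero-στ k))))
    adjacent k {2F} {1F} _   = adj-sym (edge (proj₂ (proj₂ (zero-στ k))))
    adjacent k {2F} {2F} i≢i = contradiction ≡.refl i≢i

    -- Equal vertices lie in the same part, and the permutation of that part is injective.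
    disjoint : ∀ {k l} → k ≢ l → ∀ i j → vertex k i ≢ vertex l j
    disjoint k≢l i j same with ≡.refl , ρk≡ρl ← ,-injective same = k≢l
      (≡.trans (≡.sym (Perm.inverseˡ (ρ i))) (≡.trans (≡.cong (ρ i ⟨$⟩ˡ_) ρk≡ρl) (Perm.inverseˡ (ρ i))))

-- The sign condition rules out graphs in which all three excesses are negative. The graph without
-- edges, for instance, satisfies the three inequalities, because products of negative excesses are
-- positive.
theorem1p5 : ∀ {c ℓ₁ ℓ₂ ℓ₃} (ℝ : Reals c ℓ₁ ℓ₂ ℓ₃) → let open Reals ℝ in
    (n : ℕ) → n ℕ.> 240 →
    (G : TripartiteGraph n) →
    (α′ β′ γ′ δa δb δc : Carrier) →
    ¬ (α′ < 0# × β′ < 0# × γ′ < 0#) →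
    fromℕ (edgeCount G 0F 1F) ≈ fromℕ n * fromℕ n - fromℕ n + α′ * n ^ δa →
    fromℕ (edgeCount G 0F 2F) ≈ fromℕ n * fromℕ n - fromℕ n + β′ * n ^ δb →
    fromℕ (edgeCount G 1F 2F) ≈ fromℕ n * fromℕ n - fromℕ n + γ′ * n ^ δc →
    α′ * β′ * n ^ (δa + δb - 1#) + γ′ * n ^ (δc - 1#) > 1# →
    γ′ * β′ * n ^ (δc + δb - 1#) + α′ * n ^ (δa - 1#) > 1# →
    α′ * γ′ * n ^ (δa + δc - 1#) + β′ * n ^ (δb - 1#) > 1# →
    TriangleFactor G
theorem1p5 ℝ n n>240 G α′ β′ γ′ δa δb δc not-all-neg e₁₂ e₁₃ e₂₃ ineq₁ ineq₂ ineq₃ =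
  decide
    (complement-split a b c n (missing-inequality n a b c A B C (scale α′ β′ γ′ δa δb δc ineq₁)))
    (complement-split c b a n (missing-inequality n c b a C B A (scale γ′ β′ α′ δc δb δa ineq₂)))
    (complement-split a c b n (missing-inequality n a c b A C B (scale α′ γ′ β′ δa δc δb ineq₃)))
  where
  open RealProperties ℝ
  open Power n {{ℕ.>-nonZero (ℕ.≤-<-trans z≤n n>240)}}
  open Counting using (complement-split)
  open Matchings using (total; triangle-matching)

  a = total (nonEdges G 0F 1F)
  b = total (nonEdges G 0F 2F)
  c = total (nonEdges G 1F 2F)

  A = excess+missing≈n (edgeCount G 0F 1F) a n (edgeCount+nonEdges G 0F 1F) e₁₂
  B = excess+missing≈n (edgeCount G 0F 2F) b n (edgeCount+nonEdges G 0F 2F) e₁₃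
  C = excess+missing≈n (edgeCount G 1F 2F) c n (edgeCount+nonEdges G 1F 2F) e₂₃

  Split : (a b c : ℕ) → Set
  Split a b c = (a ℕ.< n × b ℕ.< n × c ℕ.< (n ℕ.∸ a) ℕ.* (n ℕ.∸ b)) ⊎ (n ℕ.< a × n ℕ.< b)

  decide : Split a b c → Split c b a → Split a c b → TriangleFactor G
  decide (inj₁ (a<n , b<n , c<)) (inj₁ (c<n , _ , a<)) (inj₁ (_ , _ , b<)) =
    triangleMatching⇒factor G (triangle-matching _ _ _ a<n b<n c<n c<
      (≡.subst (a ℕ.<_) (ℕ.*-comm (n ℕ.∸ c) (n ℕ.∸ b)) a<) b<)
  -- Any two splits share one of the counts, so mixed outcomes place it on both sides of `n`.
  decide (inj₁ (a<n , _)) _ (inj₂ (n<a , _)) = contradiction n<a (ℕ.<-asym a<n)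
  decide (inj₁ (_ , b<n , _)) (inj₂ (_ , n<b)) _ = contradiction n<b (ℕ.<-asym b<n)
  decide (inj₂ (_ , n<b)) (inj₁ (_ , b<n , _)) _ = contradiction n<b (ℕ.<-asym b<n)
  -- All three counts exceed `n`, so all three excesses are negative, and with them the
  -- coefficients, as powers of `n` are positive.
  decide (inj₂ (n<a , n<b)) (inj₂ (n<c , _)) _ = contradiction
    ( α*n^x<0⇒α<0 δa (excess-neg n a A n<a)
    , α*n^x<0⇒α<0 δb (excess-neg n b B n<b)
    , α*n^x<0⇒α<0 δc (excess-neg n c C n<c) )
    not-all-neg
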